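{- For every integer $r\ge 2$, the generalised H-graph $H^2(r)$ satisfies $\chi_\rho(H^2(r))=7$ if $r\in\{2,4,7,8,11\}$, and $\chi_\rho(H^2(r))=6$ otherwise.
   Context: All graphs are simple; $d_G(u,v)$ is the shortest-path distance. A packing $k$-colouring of $G$ is a map $\pi:V(G)\to\{1,\dots,k\}$ such that for distinct $u,v$, $\pi(u)=\pi(v)=i$ implies $d_G(u,v)>i$; $\chi_\rho(G)$ is the least $k$ for which a packing $k$-colouring exists. For integers $r\ge 2$ and $\ell\ge 1$, the generalised H-graph $H^\ell(r)$ has vertex set $\{u^i_j: 0\le i\le \ell+1,\ 0\le j\le 2r-1\}$ and edge set consisting of: $u^0_ju^0_{j+1}$ and $u^{\ell+1}_ju^{\ell+1}_{j+1}$ for $0\le j\le 2r-1$ (subscripts modulo $2r$); $u^i_{2j}u^i_{2j+1}$ for $1\le i\le \ell$, $0\le j\le r-1$; and $u^i_ju^{i+1}_j$ for $0\le i\le \ell$, $0\le j\le 2r-1$. -}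

module Defs where

open import Data.Nat using (ℕ; zero; suc; _+_; _*_; _≤_; _<_)
open import Data.Fin using (Fin; toℕ)
open import Data.Product using (_×_; Σ; ∃; _,_; proj₁; proj₂)
open import Data.Sum using (_⊎_)
open import Relation.Nullary using (¬_)
open import Relation.Binary.PropositionalEquality using (_≡_; _≢_)

record Graph : Set₁ where
  field
    Vertex : Set
    Adj    : Vertex → Vertex → Set

open Graph public

data Walk (G : Graph) : Vertex G → Vertex G → ℕ → Set where
  nil  : ∀ {u} → Walk G u u 0
  cons : ∀ {u w v k} → Adj G u w → Walk G w v k → Walk G u v (suc k)

-- d_G(u,v) ≤ k  iff there is a walk (equivalently a path) of length at most k.
-- So d_G(u,v) > i  is  ¬ DistLe G u v i  (this also covers d = ∞).
DistLe : (G : Graph) → Vertex G → Vertex G → ℕ → Set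
DistLe G u v k = Σ ℕ λ m → m ≤ k × Walk G u v m

-- Colour c : Fin k stands for the colour toℕ c + 1 ∈ {1,…,k}.
colour : ∀ {k} → Fin k → ℕ
colour c = suc (toℕ c)

IsPackingColouring : (G : Graph) (k : ℕ) → (Vertex G → Fin k) → Set
IsPackingColouring G k π =
  ∀ u v → u ≢ v → π u ≡ π v → ¬ DistLe G u v (colour (π u))

PackingColourable : Graph → ℕ → Set
PackingColourable G k = Σ (Vertex G → Fin k) λ π → IsPackingColouring G k π

PackingChromaticNumber : Graph → ℕ → Set
PackingChromaticNumber G k =
  PackingColourable G k × (∀ m → m < k → ¬ PackingColourable G m)

-- Generalised H-graph H^ℓ(r): vertex u^i_j is (i , j) with i ∈ {0..ℓ+1}, j ∈ {0..2r-1}.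
-- Directed edge generators; adjacency is their symmetric closure.
data HEdge (ℓ r : ℕ) : (Fin (suc (suc ℓ)) × Fin (2 * r)) → (Fin (suc (suc ℓ)) × Fin (2 * r)) → Set where
  cyc     : ∀ i j j' → (toℕ i ≡ 0 ⊎ toℕ i ≡ suc ℓ) →
            (suc (toℕ j) ≡ toℕ j' ⊎ (suc (toℕ j) ≡ 2 * r × toℕ j' ≡ 0)) →
            HEdge ℓ r (i , j) (i , j')
  match   : ∀ i j j' m → 1 ≤ toℕ i → toℕ i ≤ ℓ →
            toℕ j ≡ 2 * m → toℕ j' ≡ suc (2 * m) →
            HEdge ℓ r (i , j) (i , j')
  vert    : ∀ i i' j → suc (toℕ i) ≡ toℕ i' →
            HEdge ℓ r (i , j) (i' , j)

H : (ℓ r : ℕ) → Graph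
H ℓ r = record
  { Vertex = Fin (suc (suc ℓ)) × Fin (2 * r)
  ; Adj    = λ x y → HEdge ℓ r x y ⊎ HEdge ℓ r y x
  }

{-# OPTIONS --safe #-}
module Submission where

-- H²(r) is a cyclic sequence of r blocks, a block being the columns 2b and 2b+1.  Colourings are
-- unrolled periodically along an infinite strip of blocks, where the distances that matter (at most 7)
-- no longer depend on r, so that everything reduces to finite computations on short windows.
--
-- Lower bounds.  Three consecutive blocks admit no packing 5-colouring.  For 6 colours, keep only the
-- positions of the colours 5 and 6: the patterns of 2, 3, 4, 5 consecutive blocks that can be completed
-- with the colours 1, …, 4 are few, and those of 5 blocks form a graph without closed walk of length
-- 4, 7, 8 or 11, whereas a packing 6-colouring of H²(r) yields a closed walk of length r.
-- In H²(2) the unrolling creates spurious repetitions, and the ring itself is searched.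
--
-- Upper bounds.  A graph of coloured blocks all of whose walks are locally valid turns every closed
-- walk of length r into a packing colouring of H²(r); joining closed walks gives all values of r.

open import Defs
open import Data.Bool using (Bool; true; false; T; not; if_then_else_; _∧_; _∨_; T?)
open import Data.Bool.ListAction using (any; all)
open import Data.Bool.Properties using (T-≡; T-∧; T-∨)
open import Data.Fin as Fin using (Fin; toℕ; fromℕ<)
open import Data.Fin.Patterns using (0F; 1F; 2F; 3F)
open import Data.Fin.Properties using (toℕ-injective; toℕ-fromℕ<; toℕ<n; toℕ-inject≤; inject≤-injective)
open import Data.List using (List; []; _∷_; _++_; map; concatMap; concat; foldr; take; filter; upTo; replicate; length)
open import Data.List.Membership.Propositional using (_∈_; _∉_; find; lose)
open import Data.List.Membership.Propositional.Properties
open import Data.List.Properties using (map-cong)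
open import Data.List.Relation.Unary.All as All using (All; []; _∷_)
import Data.List.Relation.Unary.All.Properties as All
open import Data.List.Relation.Unary.AllPairs as AllPairs using (AllPairs; []; _∷_)
open import Data.List.Relation.Unary.Any as Any using (Any; here; there)
open import Data.List.Relation.Unary.Any.Properties using (any⁺; any⁻)
open import Data.Nat
open import Data.Nat.DivMod
open import Data.Nat.Properties
open import Data.Product using (∃; _×_; _,_; proj₁; proj₂)
import Data.Product.Properties as Product
open import Data.Sum using (_⊎_; inj₁; inj₂)
open import Data.Unit using (⊤; tt)
open import Function using (_∘_; Equivalence)
open import Relation.Binary.PropositionalEquality
open import Relation.Nullary using (¬_; Dec; contradiction; ¬?)
open import Relation.Nullary.Decidable using (True; toWitness)

-- The strip and its balls

-- (x , t , i) is the vertex of row i in column 2x + t of the strip.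
Site : Set
Site = ℕ × Fin 2 × Fin 4

column : Site → ℕ
column (x , t , _) = toℕ t + 2 * x

opposite : Fin 2 → Fin 2
opposite 0F = 1F
opposite 1F = 0F

rowNbrs : Fin 4 → List (Fin 4)
rowNbrs 0F = 1F ∷ []
rowNbrs 1F = 0F ∷ 2F ∷ []
rowNbrs 2F = 1F ∷ 3F ∷ []
rowNbrs 3F = 2F ∷ []

outer : Fin 4 → Bool
outer 0F = true
outer 1F = false
outer 2F = false
outer 3F = true

-- The strip is cut at its left end, so balls are complete only for radii up to the column of the centre.
across : Site → List Site
across (x     , 1F , i) = (suc x , 0F , i) ∷ []
across (zero  , 0F , i) = []
across (suc x , 0F , i) = (x , 1F , i) ∷ []

nbrs : Site → List Site
nbrs (x , t , i) =
  (x , opposite t , i) ∷ (if outer i then across (x , t , i) else []) ++ map (λ i′ → x , t , i′) (rowNbrs i)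

_==_ : Site → Site → Bool
(x , t , i) == (x′ , t′ , i′) = (x ≡ᵇ x′) ∧ ((toℕ t ≡ᵇ toℕ t′) ∧ (toℕ i ≡ᵇ toℕ i′))

-- Removing duplicates keeps the balls polynomial in their radius.
insert : Site → List Site → List Site
insert p ps = if any (p ==_) ps then ps else p ∷ ps

grow : List Site → List Site
grow ps = foldr insert ps (concatMap nbrs ps)

ball : ℕ → Site → List Site
ball zero    p = p ∷ []
ball (suc n) p = grow (ball n p)

==-sound : ∀ p q → T (p == q) → p ≡ q
==-sound (x , t , i) (x′ , t′ , i′) e with Equivalence.to T-∧ e
... | ex , e′ with Equivalence.to (T-∧ {toℕ t ≡ᵇ toℕ t′}) e′
... | et , ei rewrite ≡ᵇ⇒≡ x x′ ex | toℕ-injective (≡ᵇ⇒≡ (toℕ t) (toℕ t′) et) | toℕ-injective (≡ᵇ⇒≡ (toℕ i) (toℕ i′) ei) = refl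

∈-insert⁻ : ∀ {p q} ps → q ∈ insert p ps → q ≡ p ⊎ q ∈ ps
∈-insert⁻ {p} ps h with any (p ==_) ps
... | true = inj₂ h
∈-insert⁻ ps (here e)  | false = inj₁ e
∈-insert⁻ ps (there h) | false = inj₂ h

∈-insertˡ : ∀ p ps → p ∈ insert p ps
∈-insertˡ p ps with any (p ==_) ps in eq
... | false = here refl
... | true  = Any.map (λ {q} → ==-sound p q) (any⁻ (p ==_) ps (subst T (sym eq) tt))

∈-insertʳ : ∀ {p q} ps → q ∈ ps → q ∈ insert p ps
∈-insertʳ {p} ps h with any (p ==_) ps
... | true  = h
... | false = there h

∈-inserts⁻ : ∀ {q} ps rs → q ∈ foldr insert ps rs → q ∈ rs ⊎ q ∈ ps
∈-inserts⁻ ps []       h = inj₂ h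
∈-inserts⁻ ps (r ∷ rs) h with ∈-insert⁻ (foldr insert ps rs) h
... | inj₁ e = inj₁ (here e)
... | inj₂ h′ with ∈-inserts⁻ ps rs h′
... | inj₁ k = inj₁ (there k)
... | inj₂ k = inj₂ k

∈-insertsˡ : ∀ {q} ps rs → q ∈ rs → q ∈ foldr insert ps rs
∈-insertsˡ ps (r ∷ rs) (here refl) = ∈-insertˡ r (foldr insert ps rs)
∈-insertsˡ ps (r ∷ rs) (there h)   = ∈-insertʳ (foldr insert ps rs) (∈-insertsˡ ps rs h)

∈-insertsʳ : ∀ {q} ps rs → q ∈ ps → q ∈ foldr insert ps rs
∈-insertsʳ ps []       h = h
∈-insertsʳ ps (r ∷ rs) h = ∈-insertʳ (foldr insert ps rs) (∈-insertsʳ ps rs h)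

∈-grow⁻ : ∀ {q} ps → q ∈ grow ps → q ∈ ps ⊎ ∃ λ p → p ∈ ps × q ∈ nbrs p
∈-grow⁻ ps h with ∈-inserts⁻ ps (concatMap nbrs ps) h
... | inj₂ k = inj₁ k
... | inj₁ k = inj₂ (find (∈-concatMap⁻ nbrs k))

∈-grow⁺ : ∀ {p q} ps → p ∈ ps → q ∈ nbrs p → q ∈ grow ps
∈-grow⁺ ps p∈ q∈ = ∈-insertsˡ ps (concatMap nbrs ps) (∈-concatMap⁺ nbrs (Any.map (λ { refl → q∈ }) p∈))

ball-mono : ∀ {m n p q} → m ≤′ n → q ∈ ball m p → q ∈ ball n p
ball-mono (≤′-reflexive refl) h = h
ball-mono {n = suc n} {p} (≤′-step m≤n) h = ∈-insertsʳ (ball n p) (concatMap nbrs (ball n p)) (ball-mono m≤n h)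

-- `nbrs` and `ball` are made for evaluation; proofs match on this relation instead, through `nbrs⁻`
-- and `nbrs⁺`.
data Near : Site → Site → Set where
  across₀  : ∀ {x i} → T (outer i) → Near (suc x , 0F , i) (x , 1F , i)
  across₁  : ∀ {x i} → T (outer i) → Near (x , 1F , i) (suc x , 0F , i)
  within₀  : ∀ {x i} → Near (x , 0F , i) (x , 1F , i)
  within₁  : ∀ {x i} → Near (x , 1F , i) (x , 0F , i)
  vertical : ∀ {x t i i′} → i′ ∈ rowNbrs i → Near (x , t , i) (x , t , i′)

nbrs⁻ : ∀ p {q} → q ∈ nbrs p → Near p q
nbrs⁻ (x , 0F , i) (here refl) = within₀
nbrs⁻ (x , 1F , i) (here refl) = within₁
nbrs⁻ (x , t , i) (there h) with ∈-++⁻ (if outer i then across (x , t , i) else []) h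
... | inj₂ k with ∈-map⁻ _ k
... | i′ , i′∈ , refl = vertical i′∈
nbrs⁻ (x , t , i) (there h) | inj₁ k with outer i in eq
nbrs⁻ (suc x , 0F , i) (there h) | inj₁ (here refl) | true = across₀ (subst T (sym eq) tt)
nbrs⁻ (x , 1F , i) (there h)     | inj₁ (here refl) | true = across₁ (subst T (sym eq) tt)

nbrs⁺ : ∀ {p q} → Near p q → q ∈ nbrs p
nbrs⁺ within₀ = here refl
nbrs⁺ within₁ = here refl
nbrs⁺ (across₀ {i = 0F} _) = there (here refl)
nbrs⁺ (across₀ {i = 3F} _) = there (here refl)
nbrs⁺ (across₁ {i = 0F} _) = there (here refl)
nbrs⁺ (across₁ {i = 3F} _) = there (here refl)
nbrs⁺ (vertical {x} {t} {i} h) = there (∈-++⁺ʳ (if outer i then across (x , t , i) else []) (∈-map⁺ (λ i′ → x , t , i′) h))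

column-near : ∀ {p q} → Near p q → column q ≤ suc (column p) × column p ≤ suc (column q)
column-near {q = x , _} (across₀ _) rewrite *-suc 2 x = m≤n⇒m≤1+n (n≤1+n _) , ≤-refl
column-near {p = x , _} (across₁ _) rewrite *-suc 2 x = ≤-refl , m≤n⇒m≤1+n (n≤1+n _)
column-near within₀ = ≤-refl , m≤n⇒m≤1+n (n≤1+n _)
column-near within₁ = m≤n⇒m≤1+n (n≤1+n _) , ≤-refl
column-near (vertical _) = n≤1+n _ , n≤1+n _

-- An edge changes the column by at most one. The first bound keeps a ball inside a run of tiles,
-- the second keeps walks away from the cut, and together they exclude a second copy of the centre
-- in a small ball.
column-ball : ∀ n {p q} → q ∈ ball n p → column q ≤ n + column p × column p ≤ n + column q
column-ball zero (here refl) = ≤-refl , ≤-refl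
column-ball (suc n) {p} h with ∈-grow⁻ (ball n p) h
... | inj₁ k = let a , b = column-ball n k in m≤n⇒m≤1+n a , m≤n⇒m≤1+n b
... | inj₂ (w , w∈ , q∈) =
  let a , b = column-ball n w∈
      c , d = column-near (nbrs⁻ w q∈)
  in ≤-trans c (s≤s a) , ≤-trans b (≤-trans (+-monoʳ-≤ n d) (≤-reflexive (+-suc n _)))

-- Wrapping the strip around H²(r)

-- Takes the place of `_==_` for r = 2, where a ball can contain several sites over the same vertex.
sameMod : (r : ℕ) .{{_ : NonZero r}} → Site → Site → Bool
sameMod r (x , t , i) (x′ , t′ , i′) = (x % r , t , i) == (x′ % r , t′ , i′)

==-refl : ∀ p → T (p == p)
==-refl (x , t , i) = Equivalence.from T-∧ (≡⇒≡ᵇ x x refl , Equivalence.from T-∧ (≡⇒≡ᵇ (toℕ t) _ refl , ≡⇒≡ᵇ (toℕ i) _ refl))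

module Strip (r : ℕ) .{{_ : NonZero r}} where

  place-< : (t : Fin 2) (b : ℕ) → toℕ t + 2 * (b % r) < 2 * r
  place-< t b = <-≤-trans (+-monoˡ-< (2 * (b % r)) (toℕ<n t))
    (≤-trans (≤-reflexive (sym (*-suc 2 (b % r)))) (*-monoʳ-≤ 2 (m%n<n b r)))

  place : Fin 2 → ℕ → Fin (2 * r)
  place t b = fromℕ< (place-< t b)

  toℕ-place : ∀ t b → toℕ (place t b) ≡ toℕ t + 2 * (b % r)
  toℕ-place t b = toℕ-fromℕ< (place-< t b)

  -- The strip is wrapped around H²(r) with its block 0 on the block o.
  vertex : ℕ → Site → Vertex (H 2 r)
  vertex o (x , t , i) = i , place t (x + o)

  vertex-periodic : ∀ o p → vertex (r + o) p ≡ vertex o p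
  vertex-periodic o (x , t , i) = cong (i ,_) (toℕ-injective (trans (toℕ-place t _)
    (trans (cong (λ b → toℕ t + 2 * b) shift) (sym (toℕ-place t (x + o))))))
    where
    shift : (x + (r + o)) % r ≡ (x + o) % r
    shift = trans (cong (_% r) (trans (cong (x +_) (+-comm r o)) (sym (+-assoc x o r)))) ([m+n]%n≡m%n (x + o) r)

  -- The two cases are those of `cyc`: an ordinary step to the next column, or the step that closes
  -- the cycle.
  suc-% : ∀ b → (suc (b % r) < r × suc b % r ≡ suc (b % r)) ⊎ (suc (b % r) ≡ r × suc b % r ≡ 0)
  suc-% b with m≤n⇒m<n∨m≡n (m%n<n b r)
    | trans (cong (λ y → suc y % r) (m≡m%n+[m/n]*n b r)) ([m+kn]%n≡m%n (suc (b % r)) (b / r) r)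
  ... | inj₁ lt | e = inj₁ (lt , trans e (m<n⇒m%n≡m lt))
  ... | inj₂ eq | e = inj₂ (eq , trans e (trans (cong (_% r) eq) (n%n≡0 r)))

  ends⁺ : ∀ i → T (outer i) → toℕ i ≡ 0 ⊎ toℕ i ≡ 3
  ends⁺ 0F _ = inj₁ refl
  ends⁺ 3F _ = inj₂ refl

  ends⁻ : ∀ i → toℕ i ≡ 0 ⊎ toℕ i ≡ 3 → T (outer i)
  ends⁻ 0F _ = tt
  ends⁻ 1F (inj₁ ())
  ends⁻ 1F (inj₂ ())
  ends⁻ 2F (inj₁ ())
  ends⁻ 2F (inj₂ ())
  ends⁻ 3F _ = tt

  rowNbrs⁻ : ∀ i {i′} → i′ ∈ rowNbrs i → suc (toℕ i) ≡ toℕ i′ ⊎ suc (toℕ i′) ≡ toℕ i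
  rowNbrs⁻ 0F (here refl) = inj₁ refl
  rowNbrs⁻ 1F (here refl) = inj₂ refl
  rowNbrs⁻ 1F (there (here refl)) = inj₁ refl
  rowNbrs⁻ 2F (here refl) = inj₂ refl
  rowNbrs⁻ 2F (there (here refl)) = inj₁ refl
  rowNbrs⁻ 3F (here refl) = inj₂ refl

  rowNbrs⁺ : ∀ i i′ → suc (toℕ i) ≡ toℕ i′ → i′ ∈ rowNbrs i × i ∈ rowNbrs i′
  rowNbrs⁺ 0F 1F refl = here refl , here refl
  rowNbrs⁺ 1F 2F refl = there (here refl) , here refl
  rowNbrs⁺ 2F 3F refl = there (here refl) , here refl

  withinEdge : ∀ i b → HEdge 2 r (i , place 0F b) (i , place 1F b)
  withinEdge 0F b = cyc 0F _ _ (inj₁ refl) (inj₁ (trans (cong suc (toℕ-place 0F b)) (sym (toℕ-place 1F b))))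
  withinEdge 1F b = match 1F _ _ (b % r) (s≤s z≤n) (s≤s z≤n) (toℕ-place 0F b) (toℕ-place 1F b)
  withinEdge 2F b = match 2F _ _ (b % r) (s≤s z≤n) (s≤s (s≤s z≤n)) (toℕ-place 0F b) (toℕ-place 1F b)
  withinEdge 3F b = cyc 3F _ _ (inj₂ refl) (inj₁ (trans (cong suc (toℕ-place 0F b)) (sym (toℕ-place 1F b))))

  acrossEdge : ∀ i b → T (outer i) → HEdge 2 r (i , place 1F b) (i , place 0F (suc b))
  acrossEdge i b h = cyc i _ _ (ends⁺ i h) (link (suc-% b))
    where
    next : suc (toℕ (place 1F b)) ≡ 2 * suc (b % r)
    next = trans (cong suc (toℕ-place 1F b)) (sym (*-suc 2 (b % r)))
    link : (suc (b % r) < r × suc b % r ≡ suc (b % r)) ⊎ (suc (b % r) ≡ r × suc b % r ≡ 0) →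
      suc (toℕ (place 1F b)) ≡ toℕ (place 0F (suc b)) ⊎
      (suc (toℕ (place 1F b)) ≡ 2 * r × toℕ (place 0F (suc b)) ≡ 0)
    link (inj₁ (_ , e)) = inj₁ (trans next (trans (cong (2 *_) (sym e)) (sym (toℕ-place 0F (suc b)))))
    link (inj₂ (e , z)) = inj₂ (trans next (cong (2 *_) e) , trans (toℕ-place 0F (suc b)) (cong (2 *_) z))

  near-adj : ∀ o {p q} → Near p q → Adj (H 2 r) (vertex o p) (vertex o q)
  near-adj o (across₀ {x} {i} h) = inj₂ (acrossEdge i (x + o) h)
  near-adj o (across₁ {x} {i} h) = inj₁ (acrossEdge i (x + o) h)
  near-adj o (within₀ {x} {i}) = inj₁ (withinEdge i (x + o))
  near-adj o (within₁ {x} {i}) = inj₂ (withinEdge i (x + o))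
  near-adj o (vertical {i = i} h) with rowNbrs⁻ i h
  ... | inj₁ e = inj₁ (vert _ _ _ e)
  ... | inj₂ e = inj₂ (vert _ _ _ e)

  -- Balls grow at the far end, whereas `cons` extends a walk at its start; `_∷ʳ_` and `unsnoc`
  -- mediate.
  _∷ʳ_ : ∀ {G u v w k} → Walk G u v k → Adj G v w → Walk G u w (suc k)
  nil      ∷ʳ b = cons b nil
  cons a p ∷ʳ b = cons a (p ∷ʳ b)

  unsnoc : ∀ {G u w k} → Walk G u w (suc k) → ∃ λ v → Walk G u v k × Adj G v w
  unsnoc (cons a nil) = _ , nil , a
  unsnoc (cons a (cons b p)) with unsnoc (cons b p)
  ... | v , q , c = v , cons a q , c

  -- No distance from the cut is required: strip edges map to edges, and cutting only makes balls
  -- smaller. Hence the lower bounds may use windows that start at the cut.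
  ball-walk : ∀ o n {p q} → q ∈ ball n p → DistLe (H 2 r) (vertex o p) (vertex o q) n
  ball-walk o zero (here refl) = 0 , z≤n , nil
  ball-walk o (suc n) {p} h with ∈-grow⁻ (ball n p) h
  ... | inj₁ k = let m , m≤n , w = ball-walk o n k in m , m≤n⇒m≤1+n m≤n , w
  ... | inj₂ (v , v∈ , q∈) = let m , m≤n , w = ball-walk o n v∈ in
    suc m , s≤s m≤n , w ∷ʳ near-adj o (nbrs⁻ v q∈)

  side-unique : ∀ (t t′ : Fin 2) {m m′} → toℕ t + 2 * m ≡ toℕ t′ + 2 * m′ → t ≡ t′ × m ≡ m′
  side-unique 0F 0F e = refl , *-cancelˡ-≡ _ _ 2 e
  side-unique 0F 1F {m} {m′} e = contradiction e (even≢odd m m′)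
  side-unique 1F 0F {m} {m′} e = contradiction (sym e) (even≢odd m′ m)
  side-unique 1F 1F e = refl , *-cancelˡ-≡ _ _ 2 (suc-injective e)

  place-≡ : ∀ t b (j : Fin (2 * r)) → toℕ j ≡ toℕ t + 2 * (b % r) → place t b ≡ j
  place-≡ t b j e = toℕ-injective (trans (toℕ-place t b) (sym e))

  forward : ∀ o x t i j′ → T (outer i) →
    suc (toℕ (place t (x + o))) ≡ toℕ j′ ⊎ (suc (toℕ (place t (x + o))) ≡ 2 * r × toℕ j′ ≡ 0) →
    ∃ λ q → Near (x , t , i) q × vertex o q ≡ (i , j′)
  forward o x 0F i j′ h (inj₁ e) = (x , 1F , i) , within₀ ,
    cong (i ,_) (place-≡ 1F (x + o) j′ (trans (sym e) (cong suc (toℕ-place 0F (x + o)))))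
  forward o x 0F i j′ h (inj₂ (e , _)) =
    contradiction (trans (sym e) (cong suc (toℕ-place 0F (x + o)))) (even≢odd r ((x + o) % r))
  forward o x 1F i j′ h e = (suc x , 0F , i) , across₁ h , cong (i ,_) (place-≡ 0F (suc x + o) j′ (link e (suc-% b)))
    where
    b = x + o
    next : suc (toℕ (place 1F b)) ≡ 2 * suc (b % r)
    next = trans (cong suc (toℕ-place 1F b)) (sym (*-suc 2 (b % r)))
    link : suc (toℕ (place 1F b)) ≡ toℕ j′ ⊎ (suc (toℕ (place 1F b)) ≡ 2 * r × toℕ j′ ≡ 0) →
      (suc (b % r) < r × suc b % r ≡ suc (b % r)) ⊎ (suc (b % r) ≡ r × suc b % r ≡ 0) →
      toℕ j′ ≡ 2 * (suc b % r)
    link (inj₁ e) (inj₁ (_ , f)) = trans (sym e) (trans next (cong (2 *_) (sym f)))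
    link (inj₁ e) (inj₂ (f , _)) =
      contradiction (trans (sym e) (trans next (cong (2 *_) f))) (<⇒≢ (toℕ<n j′))
    link (inj₂ (e , _)) (inj₁ (lt , _)) =
      contradiction (*-cancelˡ-≡ _ _ 2 (trans (sym next) e)) (<⇒≢ lt)
    link (inj₂ (_ , z)) (inj₂ (_ , f)) = trans z (cong (2 *_) (sym f))

  backward : ∀ o x t i j → 0 < column (x , t , i) → T (outer i) →
    suc (toℕ j) ≡ toℕ (place t (x + o)) ⊎ (suc (toℕ j) ≡ 2 * r × toℕ (place t (x + o)) ≡ 0) →
    ∃ λ q → Near (x , t , i) q × vertex o q ≡ (i , j)
  backward o x 1F i j _ h (inj₁ e) = (x , 0F , i) , within₁ ,
    cong (i ,_) (place-≡ 0F (x + o) j (suc-injective (trans e (toℕ-place 1F (x + o)))))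
  backward o x 1F i j _ h (inj₂ (_ , z)) = contradiction (trans (sym z) (toℕ-place 1F (x + o))) λ ()
  backward o (suc x) 0F i j _ h e = (x , 1F , i) , across₀ h ,
    cong (i ,_) (place-≡ 1F b j (suc-injective (trans (link e (suc-% b)) (*-suc 2 (b % r)))))
    where
    b = x + o
    link : suc (toℕ j) ≡ toℕ (place 0F (suc b)) ⊎ (suc (toℕ j) ≡ 2 * r × toℕ (place 0F (suc b)) ≡ 0) →
      (suc (b % r) < r × suc b % r ≡ suc (b % r)) ⊎ (suc (b % r) ≡ r × suc b % r ≡ 0) →
      suc (toℕ j) ≡ 2 * suc (b % r)
    link (inj₁ e) (inj₁ (_ , f)) = trans e (trans (toℕ-place 0F (suc b)) (cong (2 *_) f))
    link (inj₁ e) (inj₂ (_ , f)) = contradiction (trans e (trans (toℕ-place 0F (suc b)) (cong (2 *_) f))) λ ()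
    link (inj₂ (_ , z)) (inj₁ (_ , f)) =
      contradiction (trans (sym z) (trans (toℕ-place 0F (suc b)) (cong (2 *_) f))) λ ()
    link (inj₂ (e , _)) (inj₂ (f , _)) = trans e (cong (2 *_) (sym f))

  -- The strip covers H²(r), so edges lift; only column 0, where the left neighbour is cut off, is
  -- excluded.
  adj-near : ∀ o p {v} → 0 < column p → Adj (H 2 r) (vertex o p) v → ∃ λ q → Near p q × vertex o q ≡ v
  adj-near o (x , t , i) h (inj₁ (cyc _ _ j′ c e)) = forward o x t i j′ (ends⁻ i c) e
  adj-near o (x , t , i) h (inj₂ (cyc _ j _ c e)) = backward o x t i j h (ends⁻ i c) e
  adj-near o (x , t , i) h (inj₁ (vert _ i′ _ e)) = (x , t , i′) , vertical (proj₁ (rowNbrs⁺ i i′ e)) , refl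
  adj-near o (x , t , i) h (inj₂ (vert i′ _ _ e)) = (x , t , i′) , vertical (proj₂ (rowNbrs⁺ i′ i e)) , refl
  adj-near o (x , t , i) h (inj₁ (match _ _ j′ m _ _ e e′))
    with side-unique t 0F {(x + o) % r} {m} (trans (sym (toℕ-place t (x + o))) e)
  ... | refl , eq = (x , 1F , i) , within₀ ,
    cong (i ,_) (place-≡ 1F (x + o) j′ (trans e′ (cong (λ y → suc (2 * y)) (sym eq))))
  adj-near o (x , t , i) h (inj₂ (match _ j _ m _ _ e e′))
    with side-unique t 1F {(x + o) % r} {m} (trans (sym (toℕ-place t (x + o))) e′)
  ... | refl , eq = (x , 0F , i) , within₁ ,
    cong (i ,_) (place-≡ 0F (x + o) j (trans e (cong (2 *_) (sym eq))))

  -- Path lifting: a walk is lifted edge by edge, and the bound on `m` stops the lift from being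
  -- continued out of column 0.
  walk-ball : ∀ o m {p v} → m ≤ column p → Walk (H 2 r) (vertex o p) v m → ∃ λ q → q ∈ ball m p × vertex o q ≡ v
  walk-ball o zero {p} _ nil = p , here refl , refl
  walk-ball o (suc m) {p} h w with unsnoc w
  ... | u , w′ , a with walk-ball o m (<⇒≤ h) w′
  -- After `m` steps the column has dropped by at most `m`, which is less than `column p`, so it is
  -- still positive.
  ... | q , q∈ , refl with adj-near o q (+-cancelˡ-< m 0 _
        (<-≤-trans (subst (_< column p) (sym (+-identityʳ m)) h) (proj₂ (column-ball m q∈)))) a
  ... | q′ , n , e = q′ , ∈-grow⁺ (ball m p) q∈ (nbrs⁺ n) , e

  dist-ball : ∀ o n {p v} → n ≤ column p → DistLe (H 2 r) (vertex o p) v n → ∃ λ q → q ∈ ball n p × vertex o q ≡ v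
  dist-ball o n h (m , m≤n , w) with walk-ball o m (≤-trans m≤n h) w
  ... | q , q∈ , e = q , ball-mono (≤⇒≤′ m≤n) q∈ , e

  -- Congruent numbers with different quotients differ by at least `r`.
  %-injective : ∀ {a b} → a ≤ b → b < r + a → a % r ≡ b % r → a ≡ b
  %-injective {a} {b} a≤b b<r+a e with m≤n⇒m<n∨m≡n (/-monoˡ-≤ r a≤b)
  ... | inj₂ q = trans (m≡m%n+[m/n]*n a r) (trans (cong₂ (λ y z → y + z * r) e q) (sym (m≡m%n+[m/n]*n b r)))
  ... | inj₁ q = contradiction b<r+a (≤⇒≯ (begin
    r + a                      ≡⟨ cong (r +_) (m≡m%n+[m/n]*n a r) ⟩
    r + (a % r + a / r * r)    ≡⟨ +-comm r _ ⟩
    a % r + a / r * r + r      ≡⟨ +-assoc (a % r) _ r ⟩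
    a % r + (a / r * r + r)    ≡⟨ cong₂ _+_ e (+-comm _ r) ⟩
    b % r + suc (a / r) * r    ≤⟨ +-monoʳ-≤ (b % r) (*-monoˡ-≤ r q) ⟩
    b % r + b / r * r          ≡⟨ m≡m%n+[m/n]*n b r ⟨
    b                          ∎))
    where open ≤-Reasoning

  vertex-% : ∀ o x t i x′ t′ i′ → vertex o (x , t , i) ≡ vertex o (x′ , t′ , i′) →
    t ≡ t′ × i ≡ i′ × (x + o) % r ≡ (x′ + o) % r
  vertex-% o x t i x′ t′ i′ e with Product.,-injective e
  ... | refl , f with side-unique t t′ (trans (sym (toℕ-place t (x + o))) (trans (cong toℕ f) (toℕ-place t′ (x′ + o))))
  ... | refl , g = refl , refl , g

  -- Equal vertices have equal sides, so the columns differ by twice the difference of the block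
  -- indices. This is at most `n`, hence the indices differ by less than `r`, and being congruent
  -- they agree.
  vertex-injective : ∀ o n {p q} → n < 2 * r → q ∈ ball n p → vertex o p ≡ vertex o q → p ≡ q
  vertex-injective o n {p@(x , t , i)} {q@(x′ , t′ , i′)} n<2r h e
    with column-ball n h | vertex-% o x t i x′ t′ i′ e
  ... | a , b | refl , refl , g = cong (λ y → y , t , i) (close (≤-total x x′))
    where
    gap : ∀ {y y′} → toℕ t + 2 * y′ ≤ n + (toℕ t + 2 * y) → y′ + o < r + (y + o)
    gap {y} {y′} h = subst (y′ + o <_) (+-assoc r y o) (+-monoˡ-< o (*-cancelˡ-< 2 y′ (r + y) (begin-strict
      2 * y′         ≤⟨ +-cancelˡ-≤ (toℕ t) _ _ (≤-trans h (≤-reflexive swap)) ⟩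
      n + 2 * y      <⟨ +-monoˡ-< (2 * y) n<2r ⟩
      2 * r + 2 * y  ≡⟨ *-distribˡ-+ 2 r y ⟨
      2 * (r + y)    ∎)))
      where
      open ≤-Reasoning
      swap : n + (toℕ t + 2 * y) ≡ toℕ t + (n + 2 * y)
      swap = trans (sym (+-assoc n (toℕ t) _)) (trans (cong (_+ 2 * y) (+-comm n (toℕ t))) (+-assoc (toℕ t) n _))
    close : x ≤ x′ ⊎ x′ ≤ x → x ≡ x′
    close (inj₁ l) = +-cancelʳ-≡ o x x′ (%-injective (+-monoˡ-≤ o l) (gap a) g)
    close (inj₂ l) = sym (+-cancelʳ-≡ o x′ x (%-injective (+-monoˡ-≤ o l) (gap b) (sym g)))

  vertex-cong : ∀ o x x′ t i → (x + o) % r ≡ (x′ + o) % r → vertex o (x , t , i) ≡ vertex o (x′ , t , i)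
  vertex-cong o x x′ t i e = cong (i ,_) (place-≡ t (x + o) (place t (x′ + o))
    (trans (toℕ-place t (x′ + o)) (cong (λ m → toℕ t + 2 * m) (sym e))))

  sameMod-sound : ∀ o p q → T (sameMod r p q) → vertex o p ≡ vertex o q
  sameMod-sound o (x , t , i) (x′ , t′ , i′) h
    with e , refl ← Product.,-injective (==-sound (x % r , t , i) (x′ % r , t′ , i′) h) = vertex-cong o x x′ t i (begin
      (x + o) % r           ≡⟨ %-distribˡ-+ x o r ⟩
      (x % r + o % r) % r   ≡⟨ cong (λ y → (y + o % r) % r) e ⟩
      (x′ % r + o % r) % r  ≡⟨ %-distribˡ-+ x′ o r ⟨
      (x′ + o) % r          ∎)
    where open ≡-Reasoning

  sameMod-complete : ∀ p q → vertex 0 p ≡ vertex 0 q → T (sameMod r p q)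
  sameMod-complete (x , t , i) (x′ , t′ , i′) e with vertex-% 0 x t i x′ t′ i′ e
  ... | refl , refl , g = subst (λ y → T ((x % r , t , i) == (y , t , i)))
    (trans (cong (_% r) (sym (+-identityʳ x))) (trans g (cong (_% r) (+-identityʳ x′)))) (==-refl (x % r , t , i))

-- Exhaustive search

-- Sites are coloured in a fixed order.  An option for a site is a colour together with the mask of
-- the later sites that this choice bars from the same colour; the search state holds, for each colour,
-- the mask of the remaining sites barred from it.  Here and below the colour c stands for c + 1.
Mask Option : Set
Mask = List Bool
Option = ℕ × Mask

top : Mask → Bool
top []      = false
top (x ∷ _) = x

rest : Mask → Mask
rest []      = []
rest (_ ∷ m) = m

_⊔ₘ_ : Mask → Mask → Mask
[]      ⊔ₘ m       = m
(x ∷ l) ⊔ₘ []      = x ∷ l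
(x ∷ l) ⊔ₘ (y ∷ m) = (x ∨ y) ∷ (l ⊔ₘ m)

blocked : ℕ → List Mask → Bool
blocked c       []       = false
blocked zero    (m ∷ ms) = top m
blocked (suc c) (m ∷ ms) = blocked c ms

block : ℕ → Mask → List Mask → List Mask
block c       l []       = []
block zero    l (m ∷ ms) = (l ⊔ₘ m) ∷ ms
block (suc c) l (m ∷ ms) = m ∷ block c l ms

mutual
  refutes : List (List Option) → List Mask → Bool
  refutes []       ms = false
  refutes (os ∷ rs) ms = refutesAll (refutes rs) ms (map rest ms) os

  refutesAll : (List Mask → Bool) → List Mask → List Mask → List Option → Bool
  refutesAll k ms ms′ []            = true
  refutesAll k ms ms′ ((c , m) ∷ os) = (blocked c ms ∨ k (block c m ms′)) ∧ refutesAll k ms ms′ os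

-- A mask bars nothing beyond its end; in particular `[]` is the empty mask of any length.
Avoids : (Site → ℕ) → ℕ → Mask → List Site → Set
Avoids g c []      _        = ⊤
Avoids g c (_ ∷ _) []       = ⊤
Avoids g c (x ∷ m) (p ∷ ps) = (T x → g p ≢ c) × Avoids g c m ps

Indexed : (ℕ → Mask → Set) → List Mask → Set
Indexed P []       = ⊤
Indexed P (m ∷ ms) = P 0 m × Indexed (P ∘ suc) ms

-- Only the option actually taken by g has to be faithful: refuting all options refutes that one.
data Rows (g : Site → ℕ) : List Site → List (List Option) → Set where
  []  : ∀ {ps} → Rows g ps []
  row : ∀ {p ps m os rs} → (g p , m) ∈ os → Avoids g (g p) m ps → Rows g ps rs → Rows g (p ∷ ps) (os ∷ rs)

Avoids-⊔ : ∀ {g c} l m ps → Avoids g c l ps → Avoids g c m ps → Avoids g c (l ⊔ₘ m) ps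
Avoids-⊔ []      m       ps       _       b       = b
Avoids-⊔ (x ∷ l) []      ps       a       _       = a
Avoids-⊔ (x ∷ l) (y ∷ m) []       _       _       = tt
Avoids-⊔ (x ∷ l) (y ∷ m) (p ∷ ps) (a , as) (b , bs) = f , Avoids-⊔ l m ps as bs
  where
  f : T (x ∨ y) → _
  f h with Equivalence.to (T-∨ {x}) h
  ... | inj₁ k = a k
  ... | inj₂ k = b k

Avoids-rest : ∀ {g c p} m ps → Avoids g c m (p ∷ ps) → Avoids g c (rest m) ps
Avoids-rest []      ps _        = tt
Avoids-rest (x ∷ m) ps (_ , as) = as

Indexed-rest : ∀ {P Q : ℕ → Mask → Set} → (∀ c m → P c m → Q c (rest m)) → ∀ ms → Indexed P ms → Indexed Q (map rest ms)
Indexed-rest f []       _        = tt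
Indexed-rest f (m ∷ ms) (a , as) = f 0 m a , Indexed-rest (f ∘ suc) ms as

Indexed-block : ∀ {P : ℕ → Mask → Set} c l → (∀ m → P c m → P c (l ⊔ₘ m)) → ∀ ms → Indexed P ms → Indexed P (block c l ms)
Indexed-block c       l f []       _        = tt
Indexed-block zero    l f (m ∷ ms) (a , as) = f m a , as
Indexed-block (suc c) l f (m ∷ ms) (a , as) = a , Indexed-block c l f ms as

Indexed-blocked : ∀ {P : ℕ → Mask → Set} c ms → Indexed P ms → T (blocked c ms) → ∃ λ m → P c m × T (top m)
Indexed-blocked zero    (m ∷ ms) (a , _)  h = m , a , h
Indexed-blocked (suc c) (m ∷ ms) (_ , as) h = Indexed-blocked c ms as h

refutesAll-∈ : ∀ k ms ms′ {c m} os → T (refutesAll k ms ms′ os) → (c , m) ∈ os → T (blocked c ms) ⊎ T (k (block c m ms′))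
refutesAll-∈ k ms ms′ ((c , m) ∷ os) h (here refl) =
  Equivalence.to T-∨ (proj₁ (Equivalence.to (T-∧ {blocked c ms ∨ k (block c m ms′)}) h))
refutesAll-∈ k ms ms′ ((c , m) ∷ os) h (there i) =
  refutesAll-∈ k ms ms′ os (proj₂ (Equivalence.to (T-∧ {blocked c ms ∨ k (block c m ms′)}) h)) i

-- The invariant is that the masks tell the truth about `g`: no barred site has the barred colour.
-- Following the option taken by `g` preserves it, so that branch is never blocked and reaches the
-- end of the rows, where `refutes` is `false`.
refutes-sound : ∀ {g ps rs} → Rows g ps rs → ∀ ms → Indexed (λ c m → Avoids g c m ps) ms → ¬ T (refutes rs ms)
refutes-sound [] ms _ ()
refutes-sound {g} (row {p} {ps} {m} {os} {rs} i a rows) ms inv h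
  with refutesAll-∈ (refutes rs) ms (map rest ms) os h i
... | inj₂ h′ = refutes-sound rows (block (g p) m (map rest ms))
  (Indexed-block {λ c m → Avoids g c m ps} (g p) m (λ m′ → Avoids-⊔ m m′ ps a) (map rest ms)
    (Indexed-rest (λ c m → Avoids-rest m ps) ms inv)) h′
... | inj₁ b with Indexed-blocked (g p) ms inv b
... | x ∷ _ , (f , _) , t = f t refl

free : ℕ → List Mask
free K = replicate K []

Indexed-free : ∀ {g : Site → ℕ} {ps} (f : ℕ → ℕ) K → Indexed (λ c m → Avoids g (f c) m ps) (free K)
Indexed-free f zero    = tt
Indexed-free f (suc K) = tt , Indexed-free (f ∘ suc) K

mask : (Site → Site → Bool) → List Site → List Site → Mask
mask same ball ps = map (λ q → any (same q) ball) ps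

options : (Site → Site → Bool) → ℕ → List Site → List (List Option)
options same K []       = []
options same K (p ∷ ps) = map (λ c → c , mask same (ball (suc c) p) ps) (upTo K) ∷ options same K ps

Repels : (Site → Site → Bool) → (Site → ℕ) → Site → Site → Set
Repels same g p q = ∀ c → T (any (same q) (ball (suc c) p)) → g p ≡ c → g q ≢ c

options-rows : ∀ same {g K} → (∀ p → g p < K) → ∀ {ps} → AllPairs (Repels same g) ps → Rows g ps (options same K ps)
options-rows same g<K [] = []
options-rows same {g} g<K {p ∷ ps} (a ∷ as) = row (∈-map⁺ _ (∈-upTo⁺ (g<K p))) (avoids a) (options-rows same g<K as)
  where
  avoids : ∀ {qs} → All (Repels same g p) qs → Avoids g (g p) (mask same (ball (suc (g p)) p) qs) qs
  avoids []       = tt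
  avoids (h ∷ hs) = (λ t → h (g p) t refl) , avoids hs

blockSites : ℕ → List Site
blockSites x = (x , 0F , 0F) ∷ (x , 0F , 1F) ∷ (x , 0F , 2F) ∷ (x , 0F , 3F) ∷
               (x , 1F , 0F) ∷ (x , 1F , 1F) ∷ (x , 1F , 2F) ∷ (x , 1F , 3F) ∷ []

window : ℕ → List Site
window k = concatMap blockSites (upTo k)

-- Packing colourings read on the strip

module Colouring (r : ℕ) .{{_ : NonZero r}} {K : ℕ} (π : Vertex (H 2 r) → Fin K) (packing : IsPackingColouring (H 2 r) K π) where
  open Strip r

  colourAt : ℕ → Site → ℕ
  colourAt o p = toℕ (π (vertex o p))

  colourAt-< : ∀ o p → colourAt o p < K
  colourAt-< o p = toℕ<n (π (vertex o p))

  conflict : ∀ o {c p q} → q ∈ ball (suc c) p → vertex o p ≢ vertex o q → colourAt o p ≡ c → colourAt o q ≢ c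
  conflict o {p = p} {q} q∈ p≢q refl e = packing _ _ p≢q (toℕ-injective (sym e)) (ball-walk o _ q∈)

  -- The radii that occur are at most `K`, so `vertex-injective` turns distinct sites of a ball and
  -- its centre into distinct vertices.
  repels : K < 2 * r → ∀ o {p q} → p ≢ q → Repels _==_ (colourAt o) p q
  repels K<2r o {p} {q} p≢q c h refl with find (any⁻ (q ==_) (ball (suc c) p) h)
  ... | q′ , q′∈ , e with refl ← ==-sound q q′ e =
    conflict o q′∈ (p≢q ∘ vertex-injective o _ (≤-<-trans (colourAt-< o p) K<2r) q′∈) refl

-- Six colours

T-not⁺ : ∀ {b} → ¬ T b → T (not b)
T-not⁺ {false} _ = tt
T-not⁺ {true}  h = h tt

T-not⁻ : ∀ {b} → T (not b) → ¬ T b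
T-not⁻ {false} _ ()

-- The colours 0, …, 3 are merged into the kind 6.
kind : ℕ → ℕ
kind 4 = 4
kind 5 = 5
kind _ = 6

-- In only, the sites of kind 6 are left uncoloured.
allowed only : ℕ → List Option → List Option
allowed k = filter (λ o → T? (kind (proj₁ o) ≡ᵇ k))
only k os = if k ≡ᵇ 6 then (6 , []) ∷ [] else allowed k os

restrict : (ℕ → List Option → List Option) → List ℕ → List (List Option) → List (List Option)
restrict f []       _          = []
restrict f (k ∷ ks) []         = []
restrict f (k ∷ ks) (os ∷ rs) = f k os ∷ restrict f ks rs

-- Serves both searches: `h` is `g` for `allowed` and `kind ∘ g` for `only`. It suffices that the
-- option taken by `g` survives in some form.
restrict-rows : ∀ (f : ℕ → List Option → List Option) {g h : Site → ℕ} →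
  (∀ {p ps m os} → (g p , m) ∈ os → Avoids g (g p) m ps →
    ∃ λ m′ → (h p , m′) ∈ f (kind (g p)) os × Avoids h (h p) m′ ps) →
  ∀ n {ps rs} → Rows g ps rs → Rows h ps (restrict f (map (kind ∘ g) (take n ps)) rs)
restrict-rows f choice zero    rows = []
restrict-rows f choice (suc n) {[]} rows = []
restrict-rows f choice (suc n) {p ∷ ps} [] = []
restrict-rows f choice (suc n) (row i a rows) =
  let _ , i′ , a′ = choice i a in row i′ a′ (restrict-rows f choice n rows)

allowed-∈ : ∀ {c m os} → (c , m) ∈ os → (c , m) ∈ allowed (kind c) os
allowed-∈ {c} i = ∈-filter⁺ (λ o → T? (kind (proj₁ o) ≡ᵇ kind c)) i (≡⇒≡ᵇ (kind c) (kind c) refl)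

kind-big : ∀ c → kind c ≢ 6 → kind c ≡ c
kind-big 0 h = contradiction refl h
kind-big 1 h = contradiction refl h
kind-big 2 h = contradiction refl h
kind-big 3 h = contradiction refl h
kind-big 4 _ = refl
kind-big 5 _ = refl
kind-big (suc (suc (suc (suc (suc (suc _)))))) h = contradiction refl h

-- `kind` sends a colour to itself or to 6, so a site of kind `c ≢ 6` already had colour `c`.
Avoids-kind : ∀ {g : Site → ℕ} {c} m ps → c ≢ 6 → Avoids g c m ps → Avoids (kind ∘ g) c m ps
Avoids-kind []      ps       c≢6 _        = tt
Avoids-kind (x ∷ m) []       c≢6 _        = tt
Avoids-kind {g} {c} (x ∷ m) (p ∷ ps) c≢6 (a , as) = f , Avoids-kind m ps c≢6 as
  where
  f : T x → kind (g p) ≢ c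
  f h e = a h (trans (sym (kind-big (g p) λ e′ → c≢6 (trans (sym e) e′))) e)

allowed-choice : ∀ {g : Site → ℕ} {p ps m os} → (g p , m) ∈ os → Avoids g (g p) m ps →
  ∃ λ m′ → (g p , m′) ∈ allowed (kind (g p)) os × Avoids g (g p) m′ ps
allowed-choice i a = _ , allowed-∈ i , a

only-choice : ∀ {g : Site → ℕ} {p ps m os} → (g p , m) ∈ os → Avoids g (g p) m ps →
  ∃ λ m′ → (kind (g p) , m′) ∈ only (kind (g p)) os × Avoids (kind ∘ g) (kind (g p)) m′ ps
only-choice {g} {p} {ps} {m} {os} i a with kind (g p) ≡ᵇ 6 in eq
... | true = [] , here (cong (_, []) (≡ᵇ⇒≡ (kind (g p)) 6 (subst T (sym eq) tt))) , tt
... | false = m , subst (λ c → (c , m) ∈ allowed (kind (g p)) os) (sym e) (allowed-∈ i) ,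
              Avoids-kind m ps big (subst (λ c → Avoids g c m ps) (sym e) a)
  where
  big : kind (g p) ≢ 6
  big e = subst T eq (≡⇒≡ᵇ (kind (g p)) 6 e)
  e = kind-big (g p) big

-- With rows from `options` each kind leaves a single option, so this test of the colours 4 and 5
-- does not branch; the real search is left to `fillable`. The seventh mask belongs to kind 6, which
-- is never barred.
compatible : List (List Option) → List ℕ → Bool
compatible rs ks = not (refutes (restrict only ks rs) (free 7))

fillable : List (List Option) → List ℕ → Bool
fillable rs ks = not (refutes (restrict allowed ks rs) (free 6))

compatible-sound : ∀ {g ps rs} n → Rows g ps rs → T (compatible rs (map (kind ∘ g) (take n ps)))
compatible-sound {g} {ps} {rs} n rows = T-not⁺ (refutes-sound (restrict-rows only only-choice n rows) (free 7)
  (Indexed-free {kind ∘ g} {ps} (λ c → c) 7))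

fillable-sound : ∀ {g ps rs} n → Rows g ps rs → T (fillable rs (map (kind ∘ g) (take n ps)))
fillable-sound {g} {ps} {rs} n rows = T-not⁺ (refutes-sound (restrict-rows allowed allowed-choice n rows) (free 6)
  (Indexed-free {g} {ps} (λ c → c) 6))

-- Sites are prepended because a row refers to later sites only; incompatible suffixes are thus
-- discarded early.
patterns : List (List Option) → List (List ℕ)
patterns []       = [] ∷ []
patterns (os ∷ rs) = filter (λ ks → T? (compatible (os ∷ rs) ks))
  (concatMap (λ ks → (4 ∷ ks) ∷ (5 ∷ ks) ∷ (6 ∷ ks) ∷ []) (patterns rs))

kind-∈ : ∀ c (ks : List ℕ) → kind c ∷ ks ∈ (4 ∷ ks) ∷ (5 ∷ ks) ∷ (6 ∷ ks) ∷ []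
kind-∈ 0 ks = there (there (here refl))
kind-∈ 1 ks = there (there (here refl))
kind-∈ 2 ks = there (there (here refl))
kind-∈ 3 ks = there (there (here refl))
kind-∈ 4 ks = here refl
kind-∈ 5 ks = there (here refl)
kind-∈ (suc (suc (suc (suc (suc (suc _)))))) ks = there (there (here refl))

patterns-∈ : ∀ {g ps rs} → Rows g ps rs → map (kind ∘ g) (take (length rs) ps) ∈ patterns rs
patterns-∈ [] = here refl
patterns-∈ {g} {p ∷ ps} {os ∷ rs} rows@(row i a rows′) =
  ∈-filter⁺ (λ ks → T? (compatible (os ∷ rs) ks))
    (∈-concatMap⁺ (λ ks → (4 ∷ ks) ∷ (5 ∷ ks) ∷ (6 ∷ ks) ∷ [])
      (lose (patterns-∈ rows′) (kind-∈ (g p) _)))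
    (compatible-sound (suc (length rs)) rows)

take-rows : ∀ n {g ps rs} → Rows g ps rs → Rows g ps (take n rs)
take-rows zero    rows           = []
take-rows (suc n) []             = []
take-rows (suc n) (row i a rows) = row i a (take-rows n rows)

-- Overlap graphs of words of blocks

Letter Word : Set
Letter = List ℕ
Word   = List Letter

-- Keys are only compared; a collision would merely keep more words, so no injectivity is needed.
key : ℕ → Word → ℕ
key a []             = a
key a ([] ∷ w)       = key a w
key a ((k ∷ l) ∷ w)  = key (k + 10 * a) (l ∷ w)

-- A node of a de Bruijn graph: an edge is an overlap in all but one letter. Storing both keys makes
-- each edge test one comparison of numbers.
record Entry : Set where
  constructor entry
  field
    initKey tailKey : ℕ
    word            : Word
open Entry

initial : Word → Word
initial []          = []
initial (_ ∷ [])    = []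
initial (l ∷ m ∷ w) = l ∷ initial (m ∷ w)

toEntry : Letter → Word → Entry
toEntry l w = entry (key 0 (initial (l ∷ w))) (key 0 w) (l ∷ w)

first : Word → Letter
first []      = []
first (l ∷ _) = l

_⇝_ : Entry → Entry → Bool
e ⇝ f = tailKey e ≡ᵇ initKey f

fits : List (List Option) → Entry → Bool
fits rs e = compatible rs (concat (word e)) ∧ fillable rs (concat (word e))

overlaps : List Entry → List Entry
overlaps A = concatMap (λ f → map (λ e → toEntry (first (word e)) (word f)) (filter (λ e → T? (e ⇝ f)) A)) A

extend : List (List Option) → List Entry → List Entry
extend rs A = filter (λ e → T? (fits rs e)) (overlaps A)

-- Words read off a periodic colouring have successors and predecessors of the same kind, so dead
-- ends may be dropped.
trim : List Entry → List Entry
trim A = filter (λ e → T? (any (λ f → e ⇝ f) A ∧ any (λ f → f ⇝ e) A)) A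

follow : (Entry → Bool) → ℕ → List Entry → Bool
follow p t []      = false
follow p t (f ∷ A) = ((t ≡ᵇ initKey f) ∧ p f) ∨ follow p t A

-- A closed walk of length n + 1 through s, continued from e with n + 1 steps left.
returns : List Entry → ℕ → Entry → Entry → Bool
returns A zero    s e = e ⇝ s
returns A (suc n) s e = follow (returns A n s) (tailKey e) A

follow-∈ : ∀ p e {f} A → f ∈ A → T (e ⇝ f) → T (p f) → T (follow p (tailKey e) A)
follow-∈ p e (f ∷ A) (here refl) h k = Equivalence.from T-∨ (inj₁ (Equivalence.from T-∧ (h , k)))
follow-∈ p e (f ∷ A) (there i)   h k = Equivalence.from (T-∨ {(tailKey e ≡ᵇ initKey f) ∧ p f}) (inj₂ (follow-∈ p e A i h k))

closes : List Entry → ℕ → Bool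
closes A n = any (λ s → returns A n s s) A

module Words (letter : ℕ → Letter) where

  wordAt : ℕ → ℕ → Word
  wordAt zero    n = []
  wordAt (suc k) n = letter n ∷ wordAt k (suc n)

  entryAt : ℕ → ℕ → Entry
  entryAt k n = toEntry (letter n) (wordAt k (suc n))

  initial-wordAt : ∀ k n → initial (wordAt (suc k) n) ≡ wordAt k n
  initial-wordAt zero    n = refl
  initial-wordAt (suc k) n = cong (letter n ∷_) (initial-wordAt k (suc n))

  step : ∀ k n → T (entryAt k n ⇝ entryAt k (suc n))
  step k n = ≡⇒≡ᵇ (key 0 (wordAt k (suc n))) _ (cong (key 0) (sym (initial-wordAt k (suc n))))

  overlaps-∈ : ∀ k A → (∀ n → entryAt k n ∈ A) → ∀ n → entryAt (suc k) n ∈ overlaps A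
  overlaps-∈ k A h n = ∈-concatMap⁺ (λ f → map (λ e → toEntry (first (word e)) (word f)) (filter (λ e → T? (e ⇝ f)) A))
    (lose (h (suc n)) (∈-map⁺ (λ e → toEntry (first (word e)) (word (entryAt k (suc n))))
      (∈-filter⁺ (λ e → T? (e ⇝ entryAt k (suc n))) (h n) (step k n))))

  extend-∈ : ∀ rs k A → (∀ n → T (fits rs (entryAt (suc k) n))) → (∀ n → entryAt k n ∈ A) → ∀ n → entryAt (suc k) n ∈ extend rs A
  extend-∈ rs k A f h n = ∈-filter⁺ (λ e → T? (fits rs e)) (overlaps-∈ k A h n) (f n)

  module Periodic {r : ℕ} (periodic : ∀ n → letter (suc r + n) ≡ letter n) where

    wordAt-periodic : ∀ k n → wordAt k (suc r + n) ≡ wordAt k n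
    wordAt-periodic zero    n = refl
    wordAt-periodic (suc k) n = cong₂ _∷_ (periodic n)
      (trans (cong (wordAt k) (sym (+-suc (suc r) n))) (wordAt-periodic k (suc n)))

    entryAt-periodic : ∀ k n → entryAt k (suc r + n) ≡ entryAt k n
    entryAt-periodic k n = cong₂ toEntry (periodic n)
      (trans (cong (wordAt k) (sym (+-suc (suc r) n))) (wordAt-periodic k (suc n)))

    trim-∈ : ∀ k A → (∀ n → entryAt k n ∈ A) → ∀ n → entryAt k n ∈ trim A
    trim-∈ k A h n = ∈-filter⁺ (λ e → T? (any (λ f → e ⇝ f) A ∧ any (λ f → f ⇝ e) A)) (h n)
      (Equivalence.from T-∧
        ( any⁺ (λ f → entryAt k n ⇝ f) (lose (h (suc n)) (step k n))
        -- The predecessor is sought one period later, at `r + n`, since `n` may be 0.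
        , any⁺ (λ f → f ⇝ entryAt k n) (lose (h (r + n))
            (subst (λ e → T (entryAt k (r + n) ⇝ e)) (entryAt-periodic k n) (step k (r + n))))))

    returns-sound : ∀ k A → (∀ n → entryAt k n ∈ A) → ∀ m n {s} → entryAt k (suc m + n) ≡ s → T (returns A m s (entryAt k n))
    returns-sound k A h zero    n refl = step k n
    returns-sound k A h (suc m) n {s} e = follow-∈ (returns A m s) (entryAt k n) A (h (suc n)) (step k n)
      (returns-sound k A h m (suc n) (trans (cong (entryAt k ∘ suc) (+-suc m n)) e))

    closes-sound : ∀ k A → (∀ n → entryAt k n ∈ A) → T (closes A r)
    closes-sound k A h = any⁺ (λ s → returns A r s s)
      (lose (h 0) (returns-sound k A h r 0 (entryAt-periodic k 0)))

-- Excluding six colours for r = 4, 7, 8, 11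

grid : List (List Option)
grid = options _==_ 6 (window 5)

-- words rs k contains all patterns of k + 1 consecutive blocks.
words : List (List Option) → ℕ → List Entry
words rs zero    = map (λ l → toEntry l []) (patterns (take 8 rs))
words rs (suc k) = trim (trim (extend rs (words rs k)))

_≟ₛ_ : (p q : Site) → Dec (p ≡ q)
_≟ₛ_ = Product.≡-dec _≟_ (Product.≡-dec Fin._≟_ Fin._≟_)

window-distinct : ∀ k → {_ : True (AllPairs.allPairs? (λ p q → ¬? (p ≟ₛ q)) (window k))} → AllPairs _≢_ (window k)
window-distinct k {h} = toWitness h

module SixColouring (r : ℕ) (3<r : 3 < suc r) (π : Vertex (H 2 (suc r)) → Fin 6) (packing : IsPackingColouring (H 2 (suc r)) 6 π) where
  open Strip (suc r)
  open Colouring (suc r) π packing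

  6<2r : 6 < 2 * suc r
  6<2r = <-≤-trans (n<1+n 6) (≤-trans (n≤1+n 7) (*-monoʳ-≤ 2 3<r))

  grid-rows : ∀ o → Rows (colourAt o) (window 5) grid
  grid-rows o = options-rows _==_ (colourAt-< o) (AllPairs.map (repels 6<2r o) (window-distinct 5))

  letter : ℕ → Letter
  letter n = map (kind ∘ colourAt n) (blockSites 0)

  open Words letter

  letter-periodic : ∀ n → letter (suc r + n) ≡ letter n
  letter-periodic n = map-cong (λ p → cong (kind ∘ toℕ ∘ π) (vertex-periodic n p)) (blockSites 0)

  open Periodic letter-periodic

  letter-patterns : ∀ {rs} → length (take 8 rs) ≡ 8 → (∀ n → Rows (colourAt n) (window 5) rs) →
    ∀ n → letter n ∈ patterns (take 8 rs)
  letter-patterns {rs} e rows n =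
    subst (λ k → map (kind ∘ colourAt n) (take k (window 5)) ∈ patterns (take 8 rs)) e (patterns-∈ (take-rows 8 (rows n)))

  fits-entry : ∀ {rs} → (∀ n → Rows (colourAt n) (window 5) rs) →
    ∀ k → (∀ n → concat (wordAt (suc k) n) ≡ map (kind ∘ colourAt n) (take (8 * suc k) (window 5))) →
    ∀ n → T (fits rs (entryAt k n))
  fits-entry {rs} rows k e n = Equivalence.from T-∧
    ( subst (T ∘ compatible rs) (sym (e n)) (compatible-sound (8 * suc k) (rows n))
    , subst (T ∘ fillable rs) (sym (e n)) (fillable-sound (8 * suc k) (rows n)))

  -- Shifting the offset by x and moving to block x give the same term once x is a numeral, hence a
  -- case for each `k`; `window 5` stops at 4.
  concat-wordAt : ∀ k → k ≤ 4 → ∀ n → concat (wordAt (suc k) n) ≡ map (kind ∘ colourAt n) (take (8 * suc k) (window 5))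
  concat-wordAt 0 _ n = refl
  concat-wordAt 1 _ n = refl
  concat-wordAt 2 _ n = refl
  concat-wordAt 3 _ n = refl
  concat-wordAt 4 _ n = refl
  concat-wordAt (suc (suc (suc (suc (suc k))))) (s≤s (s≤s (s≤s (s≤s ()))))

  words-∈ : ∀ {rs} → length (take 8 rs) ≡ 8 → (∀ n → Rows (colourAt n) (window 5) rs) → ∀ k → k ≤ 4 → ∀ n → entryAt k n ∈ words rs k
  words-∈ e rows zero    _ n = ∈-map⁺ (λ l → toEntry l []) (letter-patterns e rows n)
  words-∈ {rs} e rows (suc k) h = trim-∈ (suc k) (trim (extend rs (words rs k))) (trim-∈ (suc k) (extend rs (words rs k))
    (extend-∈ rs k (words rs k) (fits-entry rows (suc k) (concat-wordAt (suc k) h)) (words-∈ e rows k (<⇒≤ h))))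

  -- Stated for variable rs and k: with the actual grid, conversion checking would run the search again.
  not-closed : ∀ rs → length (take 8 rs) ≡ 8 → (∀ n → Rows (colourAt n) (window 5) rs) →
    ∀ k → k ≤ 4 → ∀ ns → any (closes (words rs k)) ns ≡ false → r ∉ ns
  not-closed rs e rows k h ns none r∈ = subst T none
    (any⁺ (closes (words rs k)) (lose r∈ (closes-sound k (words rs k) (words-∈ e rows k h))))

-- `closes A n` looks for walks of length n + 1, so the numbers stand for 4, 7, 8 and 11.
no-closed-words : any (closes (words grid 4)) (3 ∷ 6 ∷ 7 ∷ 10 ∷ []) ≡ false
no-closed-words = refl

not-six : ∀ r → r ∈ 3 ∷ 6 ∷ 7 ∷ 10 ∷ [] → 3 ≤ r → ¬ PackingColourable (H 2 (suc r)) 6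
not-six r r∈ 3≤r (π , packing) = not-closed grid refl grid-rows 4 ≤-refl (3 ∷ 6 ∷ 7 ∷ 10 ∷ []) no-closed-words r∈
  where open SixColouring r (s≤s 3≤r) π packing

-- Five colours, and six colours on H²(2)

module Refute (r : ℕ) .{{_ : NonZero r}} {K : ℕ} (π : Vertex (H 2 r) → Fin K) (packing : IsPackingColouring (H 2 r) K π) where
  open Strip r
  open Colouring r π packing

  -- Copies of the centre inside its own ball are recognised by `sameMod` instead of being excluded
  -- by a bound on the radius.
  repels-mod : ∀ p q → ¬ T (sameMod r p q) → Repels (sameMod r) (colourAt 0) p q
  repels-mod p q p≁q c h refl with find (any⁻ (sameMod r q) (ball (suc c) p) h)
  ... | q′ , q′∈ , e = conflict 0 q′∈ (λ p≡q′ → p≁q (sameMod-complete p q (trans p≡q′ (sym q≡q′)))) refl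
      ∘ trans (cong (toℕ ∘ π) (sym q≡q′))
    where q≡q′ = sameMod-sound 0 q q′ e

  irrefutable : ∀ same {ps} → AllPairs (Repels same (colourAt 0)) ps → refutes (options same K ps) (free K) ≢ true
  irrefutable same {ps} a e =
    refutes-sound (options-rows same (colourAt-< 0) a) (free K) (Indexed-free {colourAt 0} {ps} (λ c → c) K) (subst T (sym e) tt)

five-refuted : refutes (options _==_ 5 (window 3)) (free 5) ≡ true
five-refuted = refl

-- Three blocks make six columns, so a ball of radius at most 5 contains no second copy of its
-- centre.
not-five : ∀ r → 2 ≤ r → ¬ PackingColourable (H 2 (suc r)) 5
not-five r 2≤r (π , packing) =
  irrefutable _==_ (AllPairs.map (repels (*-monoʳ-≤ 2 (s≤s 2≤r)) 0) (window-distinct 3)) five-refuted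
  where
  open Refute (suc r) π packing
  open Colouring (suc r) π packing

-- Two blocks away from the cut, so that balls wrap around in both directions.
ring : List Site
ring = blockSites 2 ++ blockSites 3

ring-distinct : AllPairs (λ p q → ¬ T (sameMod 2 p q)) ring
ring-distinct = toWitness {a? = AllPairs.allPairs? (λ p q → ¬? (T? (sameMod 2 p q))) ring} tt

six-refuted : refutes (options (sameMod 2) 6 ring) (free 6) ≡ true
six-refuted = refl

not-six-two : ¬ PackingColourable (H 2 2) 6
not-six-two (π , packing) = irrefutable (sameMod 2) {ring} ring-repels six-refuted
  where
  open Refute 2 π packing
  open Colouring 2 π packing
  ring-repels : AllPairs (Repels (sameMod 2) (colourAt 0)) ring
  ring-repels = AllPairs.map {R = λ p q → ¬ T (sameMod 2 p q)} {S = Repels (sameMod 2) (colourAt 0)}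
    (λ {p} {q} → repels-mod p q) ring-distinct

-- Colourings from tilings

all-true : ∀ {A : Set} (p : A → Bool) {x} xs → all p xs ≡ true → x ∈ xs → p x ≡ true
all-true p xs e i = Equivalence.to T-≡ (All.lookup (All.all⁺ p xs (Equivalence.from T-≡ e)) i)

digit : ℕ → ℕ → ℕ
digit n zero    = n % 10
digit n (suc k) = digit (n / 10) k

nth : ∀ {A : Set} → A → List A → ℕ → A
nth a []       _       = a
nth a (x ∷ xs) zero    = x
nth a (x ∷ xs) (suc n) = nth a xs n

-- A tile is a block whose decimal digits are the colours, column by column and each column from row 0
-- to row 3, together with the indices of the tiles that may follow it.
Tiles : Set
Tiles = List (ℕ × List ℕ)

module Tiling (k : ℕ) (tiles : Tiles) where

  states : List ℕ
  states = upTo (length tiles)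

  tint : ℕ → Fin 2 → Fin 4 → Fin (suc k)
  -- Digits are counted from the right, hence `7 ∸`. `pred` shifts the colours to start at 0, and
  -- `mod` only provides the bound required by `Fin`.
  tint a t i = pred (digit (proj₁ (nth (0 , []) tiles a)) (7 ∸ (4 * toℕ t + toℕ i))) mod suc k

  next : ℕ → List ℕ
  next a = proj₂ (nth (0 , []) tiles a)

  runs : ℕ → ℕ → List (List ℕ)
  runs zero    a = (a ∷ []) ∷ []
  runs (suc n) a = map (a ∷_) (concatMap (runs n) (next a))

  shade : List ℕ → Site → ℕ
  shade σ (x , t , i) = toℕ (tint (nth 0 σ x) t i)

  clear : (Site → Site → Bool) → Site → ℕ → List Site → List ℕ → Bool
  clear same p c ps σ = not (shade σ p ≡ᵇ c) ∨ all (λ q → same p q ∨ not (shade σ q ≡ᵇ c)) ps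

  clear-sound : ∀ same {p c ps σ q} → clear same p c ps σ ≡ true →
    shade σ p ≡ c → q ∈ ps → shade σ q ≡ c → T (same p q)
  clear-sound same {p} {c} {ps} {σ} {q} e hp q∈ hq
    with Equivalence.to (T-∨ {not (shade σ p ≡ᵇ c)}) (Equivalence.from T-≡ e)
  ... | inj₁ h = contradiction (≡⇒≡ᵇ _ _ hp) (T-not⁻ h)
  ... | inj₂ h with Equivalence.to (T-∨ {same p q}) (All.lookup (All.all⁺ _ ps h) q∈)
  ... | inj₁ g = g
  ... | inj₂ g = contradiction (≡⇒≡ᵇ _ _ hq) (T-not⁻ g)

  -- The ball is an argument, so that it is evaluated once for all runs.
  clearOn : (Site → Site → Bool) → List (List ℕ) → Site → ℕ → List Site → Bool
  clearOn same σs p c ps = all (clear same p c ps) σs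

  validOn : (Site → Site → Bool) → List (List ℕ) → List ℕ → List Site → Bool
  validOn same σs cs ps = all (λ p → all (λ c → clearOn same σs p c (ball (suc c) p)) cs) ps

  validOn-sound : ∀ same {σs cs ps σ c p} → validOn same σs cs ps ≡ true → σ ∈ σs → c ∈ cs → p ∈ ps →
    clear same p c (ball (suc c) p) σ ≡ true
  validOn-sound same {σs} {cs} {ps} {c = c} {p} e σ∈ c∈ p∈ =
    all-true (clear same p c (ball (suc c) p)) σs
      (all-true (λ c → clearOn same σs p c (ball (suc c) p)) cs
        (all-true (λ p → all (λ c → clearOn same σs p c (ball (suc c) p)) cs) ps e p∈) c∈) σ∈

  -- For `k ≤ 6` the radii are at most 7, so balls around block 4, that is columns 8 and 9, stay
  -- within columns 1 to 16. They avoid the cut and lie in the nine blocks 0 to 8 of a run.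
  Valid : (Site → Site → Bool) → Set
  Valid same = validOn same (concatMap (runs 8) states) (upTo (suc k)) (blockSites 4) ≡ true

  data Path : ℕ → ℕ → ℕ → Set where
    []   : ∀ {a} → Path a a 0
    step : ∀ {a b c n} → a ∈ states → b ∈ next a → Path b c n → Path a c (suc n)

  _⊕_ : ∀ {a b c m n} → Path a b m → Path b c n → Path a c (m + n)
  []         ⊕ q = q
  step h e p ⊕ q = step h e (p ⊕ q)

  linked : ℕ → List ℕ → Bool
  linked a []       = true
  linked a (b ∷ bs) = (any (a ≡ᵇ_) states ∧ any (b ≡ᵇ_) (next a)) ∧ linked b bs

  final : ℕ → List ℕ → ℕ
  final a []       = a
  final a (b ∷ bs) = final b bs

  ∈-any : ∀ {a} xs → T (any (a ≡ᵇ_) xs) → a ∈ xs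
  ∈-any {a} xs h = Any.map (λ {b} → ≡ᵇ⇒≡ a b) (any⁻ (a ≡ᵇ_) xs h)

  path : ∀ a bs → T (linked a bs) → Path a (final a bs) (length bs)
  path a []       _ = []
  path a (b ∷ bs) h =
    let h₁ , h₂ = Equivalence.to (T-∧ {any (a ≡ᵇ_) states ∧ any (b ≡ᵇ_) (next a)}) h
        h₃ , h₄ = Equivalence.to (T-∧ {any (a ≡ᵇ_) states}) h₁
    in step (∈-any states h₃) (∈-any (next a) h₄) (path b bs h₂)

  at : ∀ {a b n} → Path a b n → ℕ → ℕ
  at {a} []           _       = a
  at {a} (step _ _ p) zero    = a
  at     (step _ _ p) (suc m) = at p m

  at-start : ∀ {a b n} (p : Path a b n) → at p 0 ≡ a
  at-start []           = refl
  at-start (step _ _ p) = refl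

  at-end : ∀ {a b n} (p : Path a b n) → at p n ≡ b
  at-end []           = refl
  at-end (step _ _ p) = at-end p

  at-state : ∀ {a b n} (p : Path a b n) {m} → m < n → at p m ∈ states
  at-state (step h _ p) {zero}  _         = h
  at-state (step _ _ p) {suc m} (s≤s m<n) = at-state p m<n

  at-next : ∀ {a b n} (p : Path a b n) {m} → m < n → at p (suc m) ∈ next (at p m)
  at-next (step _ e p) {zero}  _         = subst (_∈ next _) (sym (at-start p)) e
  at-next (step _ _ p) {suc m} (s≤s m<n) = at-next p m<n

  -- `same` tells when two sites may share a colour because they are one vertex: equality in
  -- general, congruence of blocks for r = 2.
  module Wrap {a r : ℕ} (same : Site → Site → Bool)
    (same-sound : ∀ o p q → T (same p q) → Strip.vertex (suc r) o p ≡ Strip.vertex (suc r) o q)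
    (is-valid : Valid same) (k≤6 : k ≤ 6) (loop : Path a a (suc r)) where
    open Strip (suc r)

    state : ℕ → ℕ
    state n = at loop (n % suc r)

    state-next : ∀ n → state (suc n) ∈ next (state n)
    state-next n with suc-% n | at-next loop (m%n<n n (suc r))
    ... | inj₁ (_ , e) | h rewrite e = h
    ... | inj₂ (f , e) | h rewrite e =
      subst (_∈ next (state n)) (trans (cong (at loop) f) (trans (at-end loop) (sym (at-start loop)))) h

    run : ℕ → ℕ → List ℕ
    run zero    o = state o ∷ []
    run (suc n) o = state o ∷ run n (suc o)

    run-∈ : ∀ n o → run n o ∈ runs n (state o)
    run-∈ zero    o = here refl
    run-∈ (suc n) o = ∈-map⁺ (state o ∷_) (∈-concatMap⁺ (runs n) (lose (state-next o) (run-∈ n (suc o))))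

    nth-run : ∀ n o x → x ≤ n → nth 0 (run n o) x ≡ state (x + o)
    nth-run zero    o zero    _         = refl
    nth-run (suc n) o zero    _         = refl
    nth-run (suc n) o (suc x) (s≤s x≤n) = trans (nth-run n (suc o) x x≤n) (cong state (+-suc x o))

    π : Vertex (H 2 (suc r)) → Fin (suc k)
    π (i , j) = tint (state (toℕ j / 2)) (toℕ j mod 2) i

    place-half : ∀ t b → toℕ (place t b) mod 2 ≡ t × toℕ (place t b) / 2 ≡ b % suc r
    place-half t b with side-unique (toℕ (place t b) mod 2) t {toℕ (place t b) / 2} {b % suc r} (begin
        toℕ (j mod 2) + 2 * (j / 2)  ≡⟨ cong₂ _+_ (toℕ-fromℕ< (m%n<n j 2)) (*-comm 2 (j / 2)) ⟩
        j % 2 + j / 2 * 2            ≡⟨ m≡m%n+[m/n]*n j 2 ⟨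
        j                            ≡⟨ toℕ-place t b ⟩
        toℕ t + 2 * (b % suc r)      ∎)
      where
      open ≡-Reasoning
      j = toℕ (place t b)
    ... | e , f = e , f

    π-vertex : ∀ o x t i → π (vertex o (x , t , i)) ≡ tint (state (x + o)) t i
    π-vertex o x t i = cong₂ (λ a t′ → tint a t′ i)
      (trans (cong state (proj₂ (place-half t (x + o)))) (cong (at loop) (m%n%n≡m%n (x + o) (suc r))))
      (proj₁ (place-half t (x + o)))

    shade-run : ∀ o x t i → x ≤ 8 → shade (run 8 o) (x , t , i) ≡ toℕ (π (vertex o (x , t , i)))
    shade-run o x t i x≤8 = trans (cong (λ s → toℕ (tint s t i)) (nth-run 8 o x x≤8)) (cong toℕ (sym (π-vertex o x t i)))

    -- Block 4 of the strip then lies on the block of j, which is far enough from both ends of a run.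
    origin : Fin (2 * suc r) → ℕ
    origin j = toℕ j / 2 + 4 * r

    locate : ∀ i j → vertex (origin j) (4 , toℕ j mod 2 , i) ≡ (i , j)
    locate i j = cong (i ,_) (place-≡ (toℕ j mod 2) (4 + origin j) j (begin
      toℕ j                                         ≡⟨ m≡m%n+[m/n]*n (toℕ j) 2 ⟩
      toℕ j % 2 + toℕ j / 2 * 2                     ≡⟨ cong₂ _+_ (sym (toℕ-fromℕ< (m%n<n (toℕ j) 2))) (*-comm (toℕ j / 2) 2) ⟩
      toℕ (toℕ j mod 2) + 2 * (toℕ j / 2)           ≡⟨ cong (λ m → toℕ (toℕ j mod 2) + 2 * m) (sym wrap) ⟩
      toℕ (toℕ j mod 2) + 2 * ((4 + origin j) % suc r)  ∎))
      where
      open ≡-Reasoning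
      h = toℕ j / 2
      wrap : (4 + origin j) % suc r ≡ h
      wrap = begin
        -- `4 + 4 * r` amounts to four full turns around the ring.
        (4 + (h + 4 * r)) % suc r  ≡⟨ cong (_% suc r) (trans (sym (+-assoc 4 h (4 * r))) (trans (cong (_+ 4 * r) (+-comm 4 h)) (trans (+-assoc h 4 (4 * r)) (cong (h +_) (sym (*-suc 4 r)))))) ⟩
        (h + 4 * suc r) % suc r    ≡⟨ [m+kn]%n≡m%n h 4 (suc r) ⟩
        h % suc r                  ≡⟨ m<n⇒m%n≡m (m<n*o⇒m/o<n (subst (toℕ j <_) (*-comm 2 (suc r)) (toℕ<n j))) ⟩
        h                          ∎

    on-run : ∀ o {p c} → p ∈ blockSites 4 → c ≤ k → clear same p c (ball (suc c) p) (run 8 o) ≡ true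
    on-run o p∈ c≤k = validOn-sound same is-valid
      (∈-concatMap⁺ (runs 8) (lose (at-state loop (m%n<n o (suc r))) (run-∈ 8 o))) (∈-upTo⁺ (s≤s c≤k)) p∈

    blockSites-∈ : ∀ x t i → (x , t , i) ∈ blockSites x
    blockSites-∈ x 0F 0F = here refl
    blockSites-∈ x 0F 1F = there (here refl)
    blockSites-∈ x 0F 2F = there (there (here refl))
    blockSites-∈ x 0F 3F = there (there (there (here refl)))
    blockSites-∈ x 1F 0F = there (there (there (there (here refl))))
    blockSites-∈ x 1F 1F = there (there (there (there (there (here refl)))))
    blockSites-∈ x 1F 2F = there (there (there (there (there (there (here refl))))))
    blockSites-∈ x 1F 3F = there (there (there (there (there (there (there (here refl)))))))

    apart : ∀ o t i {q} → let u = vertex o (4 , t , i) in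
      q ∈ ball (colour (π u)) (4 , t , i) → π u ≡ π (vertex o q) → u ≡ vertex o q
    apart o t i {q@(x , t′ , i′)} q∈ e = same-sound o (4 , t , i) q
      (clear-sound same {σ = run 8 o} (on-run o (blockSites-∈ 4 t i) (≤-pred (toℕ<n (π (vertex o (4 , t , i))))))
        (shade-run o 4 t i (s≤s (s≤s (s≤s (s≤s z≤n))))) q∈
        (trans (shade-run o x t′ i′ x≤8) (cong toℕ (sym e))))
      where
      x≤8 : x ≤ 8
      -- The radius is at most 7 and the column of the centre at most 9, so `2 * x` is at most 16.
      x≤8 = *-cancelˡ-≤ 2 (≤-trans (m≤n+m (2 * x) (toℕ t′)) (≤-trans (proj₁ (column-ball (colour (π (vertex o (4 , t , i)))) {4 , t , i} q∈))
        (+-mono-≤ (s≤s (≤-trans (≤-pred (toℕ<n (π (vertex o (4 , t , i))))) k≤6)) (+-monoˡ-≤ 8 (≤-pred (toℕ<n t))))))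

    packing : IsPackingColouring (H 2 (suc r)) (suc k) π
    packing (i , j) v u≢v = separate (locate i j) u≢v
      where
      o = origin j
      t = toℕ j mod 2
      room : colour (π (vertex o (4 , t , i))) ≤ column (4 , t , i)
      room = ≤-trans (toℕ<n (π (vertex o (4 , t , i)))) (≤-trans (s≤s k≤6) (≤-trans (n≤1+n 7) (m≤n+m 8 (toℕ t))))
      -- With `u` variable, the equation from `locate` can be matched by `refl`, which moves the
      -- claim to the copy of the vertex in block 4.
      separate : ∀ {u} → vertex o (4 , t , i) ≡ u → u ≢ v → π u ≡ π v → ¬ DistLe (H 2 (suc r)) u v (colour (π u))
      separate refl u≢v πu≡πv d = let q , q∈ , e = dist-ball o (colour (π (vertex o (4 , t , i)))) {4 , t , i} room d in
        u≢v (trans (apart o t i q∈ (trans πu≡πv (cong π (sym e)))) e)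

    colourable : PackingColourable (H 2 (suc r)) (suc k)
    colourable = π , packing

-- Tiles and closed walks

-- `tiles₇` consists of the cycles 0, 1, 2 and 3, 4, 5, 6, joined by the edges from 2 to 3 and from
-- 6 to 0; this gives the lengths 4, 7, 8 and 11.
tiles₂ tiles₆ tiles₇ : Tiles
tiles₂ =
  (12133141 , 1 ∷ []) ∷
  (12156171 , 0 ∷ []) ∷ []
tiles₇ =
  (41511213 , 1 ∷ []) ∷
  (31211514 , 2 ∷ []) ∷
  (21611312 , 0 ∷ 3 ∷ []) ∷
  (41311215 , 4 ∷ []) ∷
  (31211613 , 5 ∷ []) ∷
  (51211314 , 6 ∷ []) ∷
  (21311712 , 0 ∷ 3 ∷ []) ∷ []
tiles₆ =
  (13124151 , 1 ∷ 3 ∷ []) ∷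
  (12133161 , 2 ∷ 19 ∷ []) ∷
  (15142131 , 0 ∷ []) ∷
  (12133161 , 4 ∷ []) ∷
  (15142131 , 5 ∷ []) ∷
  (43121251 , 6 ∷ []) ∷
  (62133141 , 7 ∷ []) ∷
  (15122131 , 8 ∷ []) ∷
  (13164121 , 9 ∷ []) ∷
  (12133151 , 10 ∷ []) ∷
  (12146131 , 11 ∷ []) ∷
  (13122151 , 12 ∷ 29 ∷ []) ∷
  (14133121 , 13 ∷ []) ∷
  (15162131 , 14 ∷ []) ∷
  (14123151 , 15 ∷ 28 ∷ []) ∷
  (12136141 , 16 ∷ []) ∷
  (13122151 , 17 ∷ []) ∷
  (14133126 , 18 ∷ []) ∷
  (15212134 , 0 ∷ []) ∷
  (15142131 , 20 ∷ []) ∷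
  (13124151 , 21 ∷ []) ∷
  (16133121 , 22 ∷ []) ∷
  (12145131 , 23 ∷ []) ∷
  (13122161 , 24 ∷ []) ∷
  (14153121 , 25 ∷ []) ∷
  (12135141 , 26 ∷ []) ∷
  (16122131 , 27 ∷ []) ∷
  (13154121 , 1 ∷ []) ∷
  (12136141 , 11 ∷ []) ∷
  (14133121 , 30 ∷ []) ∷
  (15162131 , 5 ∷ []) ∷ []

valid₂ : Tiling.Valid 6 tiles₂ (sameMod 2)
valid₂ = refl

valid₇ : Tiling.Valid 6 tiles₇ _==_
valid₇ = refl

valid₆ : Tiling.Valid 5 tiles₆ _==_
valid₆ = refl

==-vertex : ∀ r .{{_ : NonZero r}} o p q → T (p == q) → Strip.vertex r o p ≡ Strip.vertex r o q
==-vertex r o p q h = cong (Strip.vertex r o) (==-sound p q h)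

seven-two : PackingColourable (H 2 2) 7
seven-two = Tiling.Wrap.colourable 6 tiles₂ (sameMod 2) (Strip.sameMod-sound 2) valid₂ ≤-refl
  (Tiling.path 6 tiles₂ 0 (1 ∷ 0 ∷ []) tt)

module Seven where
  open Tiling 6 tiles₇ public

  three : Path 0 0 3
  three = path 0 (1 ∷ 2 ∷ 0 ∷ []) tt

  four : Path 3 3 4
  four = path 3 (4 ∷ 5 ∷ 6 ∷ 3 ∷ []) tt

  seven : Path 0 0 7
  seven = path 0 (1 ∷ 2 ∷ 3 ∷ 4 ∷ 5 ∷ 6 ∷ 0 ∷ []) tt

  eleven : Path 0 0 11
  eleven = path 0 (1 ∷ 2 ∷ 3 ∷ 4 ∷ 5 ∷ 6 ∷ 3 ∷ 4 ∷ 5 ∷ 6 ∷ 0 ∷ []) tt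

  colourable : ∀ {a r} → Path a a (suc r) → PackingColourable (H 2 (suc r)) 7
  colourable {r = r} = Wrap.colourable _==_ (==-vertex (suc r)) valid₇ ≤-refl

module Six where
  open Tiling 5 tiles₆ public

  three : Path 0 0 3
  three = path 0 (1 ∷ 2 ∷ 0 ∷ []) tt

  five : Path 28 28 5
  five = path 28 (11 ∷ 12 ∷ 13 ∷ 14 ∷ 28 ∷ []) tt

  thirteen : Path 0 0 13
  thirteen = path 0 (1 ∷ 19 ∷ 20 ∷ 21 ∷ 22 ∷ 23 ∷ 24 ∷ 25 ∷ 26 ∷ 27 ∷ 1 ∷ 2 ∷ 0 ∷ []) tt

  fourteen : Path 9 9 14
  fourteen = path 9 (10 ∷ 11 ∷ 12 ∷ 13 ∷ 14 ∷ 28 ∷ 11 ∷ 29 ∷ 30 ∷ 5 ∷ 6 ∷ 7 ∷ 8 ∷ 9 ∷ []) tt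

  seventeen : Path 0 0 17
  seventeen = path 0 (3 ∷ 4 ∷ 5 ∷ 6 ∷ 7 ∷ 8 ∷ 9 ∷ 10 ∷ 11 ∷ 12 ∷ 13 ∷ 14 ∷ 15 ∷ 16 ∷ 17 ∷ 18 ∷ 0 ∷ []) tt

  -- 15, 16 = 3 + 13 and 17 represent all residues modulo 3, and all these walks close at tile 0,
  -- where the loop of length 3 can be added.
  fifteen+ : ∀ n → Path 0 0 (15 + n)
  fifteen+ 0 = three ⊕ (three ⊕ (three ⊕ (three ⊕ three)))
  fifteen+ 1 = three ⊕ thirteen
  fifteen+ 2 = seventeen
  fifteen+ (suc (suc (suc n))) = three ⊕ fifteen+ n

  colourable : ∀ {a r} → Path a a (suc r) → PackingColourable (H 2 (suc r)) 6
  colourable {r = r} = Wrap.colourable _==_ (==-vertex (suc r)) valid₆ (n≤1+n 5)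

-- The packing chromatic number

exceptions : List ℕ
exceptions = 2 ∷ 4 ∷ 7 ∷ 8 ∷ 11 ∷ []

seven-colourable : ∀ r → r ∈ exceptions → PackingColourable (H 2 r) 7
seven-colourable _ (here refl)                                 = seven-two
seven-colourable _ (there (here refl))                         = Seven.colourable Seven.four
seven-colourable _ (there (there (here refl)))                 = Seven.colourable Seven.seven
seven-colourable _ (there (there (there (here refl))))         = Seven.colourable (Seven.four Seven.⊕ Seven.four)
seven-colourable _ (there (there (there (there (here refl))))) = Seven.colourable Seven.eleven

not-six-colourable : ∀ r → r ∈ exceptions → ¬ PackingColourable (H 2 r) 6
not-six-colourable _ (here refl)                                 = not-six-two
not-six-colourable _ (there (here refl))                         = not-six 3 (here refl) (m≤m+n 3 0)
not-six-colourable _ (there (there (here refl)))                 = not-six 6 (there (here refl)) (m≤m+n 3 3)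
not-six-colourable _ (there (there (there (here refl))))         = not-six 7 (there (there (here refl))) (m≤m+n 3 4)
not-six-colourable _ (there (there (there (there (here refl))))) = not-six 10 (there (there (there (here refl)))) (m≤m+n 3 7)

six-colourable : ∀ r → 2 ≤ r → r ∉ exceptions → PackingColourable (H 2 r) 6
six-colourable 1  (s≤s ()) _
six-colourable 2  _ h = contradiction (here refl) h
six-colourable 3  _ _ = Six.colourable Six.three
six-colourable 4  _ h = contradiction (there (here refl)) h
six-colourable 5  _ _ = Six.colourable Six.five
six-colourable 6  _ _ = Six.colourable (Six.three Six.⊕ Six.three)
six-colourable 7  _ h = contradiction (there (there (here refl))) h
six-colourable 8  _ h = contradiction (there (there (there (here refl)))) h
six-colourable 9  _ _ = Six.colourable (Six.three Six.⊕ (Six.three Six.⊕ Six.three))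
six-colourable 10 _ _ = Six.colourable (Six.five Six.⊕ Six.five)
six-colourable 11 _ h = contradiction (there (there (there (there (here refl))))) h
six-colourable 12 _ _ = Six.colourable (Six.three Six.⊕ (Six.three Six.⊕ (Six.three Six.⊕ Six.three)))
six-colourable 13 _ _ = Six.colourable Six.thirteen
six-colourable 14 _ _ = Six.colourable Six.fourteen
six-colourable (suc (suc (suc (suc (suc (suc (suc (suc (suc (suc (suc (suc (suc (suc (suc n))))))))))))))) _ _ =
  Six.colourable (Six.fifteen+ n)

colourable-mono : ∀ {G m k} → m ≤ k → PackingColourable G m → PackingColourable G k
colourable-mono {G} m≤k (π , packing) = (λ v → Fin.inject≤ (π v) m≤k) , λ u v u≢v e d → packing u v u≢v
  (inject≤-injective m≤k m≤k (π u) (π v) e)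
  (subst (DistLe G u v) (cong suc (toℕ-inject≤ (π u) m≤k)) d)

-- For r = 2 there are only four columns and the radius bound behind `not-five` fails; the search
-- with six colours covers this case.
not-five-colourable : ∀ r → 2 ≤ r → ¬ PackingColourable (H 2 r) 5
not-five-colourable (suc (suc zero))    _ = not-six-two ∘ colourable-mono (n≤1+n 5)
not-five-colourable (suc (suc (suc r))) _ = not-five (suc (suc r)) (s≤s (s≤s z≤n))
not-five-colourable (suc zero) (s≤s ())

theorem18 : (r : ℕ) → 2 ≤ r →
    (r ∈ 2 ∷ 4 ∷ 7 ∷ 8 ∷ 11 ∷ [] → PackingChromaticNumber (H 2 r) 7) ×
    (r ∉ 2 ∷ 4 ∷ 7 ∷ 8 ∷ 11 ∷ [] → PackingChromaticNumber (H 2 r) 6)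
theorem18 r 2≤r =
  (λ r∈ → seven-colourable r r∈ , λ m m<7 → not-six-colourable r r∈ ∘ colourable-mono (≤-pred m<7)) ,
  (λ r∉ → six-colourable r 2≤r r∉ , λ m m<6 → not-five-colourable r 2≤r ∘ colourable-mono (≤-pred m<6))
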